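{- For every integer $k\ge2$, there exist $2$-circuit bounded systems that are not $k$-growth systems.
   Context: An independence system $(S,\mathcal{I})$ is a finite set $S$ with a nonempty downward-closed family $\mathcal{I}\subseteq2^S$ of independent sets. Circuits are the inclusion-wise minimal non-independent sets. A basis of $X\subseteq S$ is an inclusion-wise maximal independent subset of $X$. $k$-growth: for all $X\subseteq S$ and all $I\in\mathcal{I}$ there is a partition $(Q,Z)$ of $I\setminus X$ with $|Z|\le k|X\setminus I|$ such that $P\cup Q\in\mathcal{I}$ for every basis $P$ of $X$. $k$-circuit bounded: for every $I\in\mathcal{I}$ and every $e\in S\setminus I$, the set $I\cup\{e\}$ contains at most $k$ distinct circuits. -}

module Defs where

open import Data.Fin.Subset using (Subset; _∉_; _⊆_; _∪_; _∩_; _─_; ⁅_⁆; ∣_∣; ⊥)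
open import Data.List.Base using (List; length)
open import Data.List.Relation.Unary.All using (All)
open import Data.List.Relation.Unary.Unique.Propositional using (Unique)
open import Data.Nat.Base using (ℕ; _*_; _≤_)
open import Data.Product.Base using (_×_; ∃; ∃₂)
open import Relation.Binary.PropositionalEquality.Core using (_≡_)
open import Relation.Nullary.Negation.Core using (¬_)
open import Relation.Unary using (Pred; Decidable)
open import Level using (0ℓ)

-- The ground set is Fin n.  Decidability makes Independent an honest
-- family of subsets, i.e. a map from subsets to truth values.
record IndependenceSystem (n : ℕ) : Set₁ where
  field
    Independent     : Pred (Subset n) 0ℓ
    independent?    : Decidable Independent
    nonempty        : ∃ Independent
    downward-closed : ∀ {I J} → J ⊆ I → Independent I → Independent J

module _ {n : ℕ} where

  Minimal : Pred (Subset n) 0ℓ → Pred (Subset n) 0ℓ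
  Minimal F A = F A × (∀ {B} → F B → B ⊆ A → B ≡ A)

  Maximal : Pred (Subset n) 0ℓ → Pred (Subset n) 0ℓ
  Maximal F A = F A × (∀ {B} → F B → A ⊆ B → B ≡ A)

  -- The two parts are allowed to be empty.
  IsPartition : Subset n → Subset n → Subset n → Set
  IsPartition Q Z A = Q ∪ Z ≡ A × Q ∩ Z ≡ ⊥

  module _ (𝓢 : IndependenceSystem n) where
    open IndependenceSystem 𝓢

    Circuit : Pred (Subset n) 0ℓ
    Circuit = Minimal (λ C → ¬ Independent C)

    Basis : Subset n → Pred (Subset n) 0ℓ
    Basis X = Maximal (λ B → Independent B × B ⊆ X)

    Growth : ℕ → Set
    Growth k = ∀ X I → Independent I →
      ∃₂ λ Q Z → IsPartition Q Z (I ─ X)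
               × ∣ Z ∣ ≤ k * ∣ X ─ I ∣
               × (∀ P → Basis X P → Independent (P ∪ Q))

    -- "At most k distinct circuits": every repetition-free list of
    -- circuits contained in I ∪ {e} has length at most k.
    CircuitBounded : ℕ → Set
    CircuitBounded k = ∀ I e → Independent I → e ∉ I →
      (Cs : List (Subset n)) → Unique Cs →
      All (λ C → Circuit C × C ⊆ I ∪ ⁅ e ⁆) Cs →
      length Cs ≤ k

{-# OPTIONS --safe #-}

-- Let S₀, S₁, … be N sets of size t in an m-element set X, any two of which
-- have at least t + 2 elements in their union.  Add new elements y₀, y₁, …
-- and take as dependent sets those that meet X in more than t elements or
-- contain some block Sⱼ ∪ {yⱼ}.
-- If I is independent, J = I ∪ {e} has at most t + 1 elements in X.  Hence J
-- contains at most one block, and the only circuit of J with more than t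
-- elements in X is J ∩ X itself: at most two circuits.
-- For Y = {y₀, y₁, …}, a set Q ⊆ Y such that P ∪ Q is independent for every
-- basis P of X is empty, since each Sⱼ is a basis of X.  So k-growth fails
-- as soon as N > k m.  Doubling the sets {aᵢ, bⱼ}, with i, j < 4k + 1, gives
-- such a family with t = 4, m = 4 (4k + 1) and N = (4k + 1)².
module Submission where

open import Defs
open import Data.Bool.Base using (true; false)
open import Data.Fin.Base using (Fin; _↑ʳ_; remQuot; combine)
open import Data.Fin.Properties
  using (all?; any?; ¬∀⟶∃¬; combine-remQuot) renaming (_≟_ to _≟ᶠ_)
open import Data.Fin.Subset
  using (Subset; _∈_; _∉_; _⊆_; _∪_; _─_; ⁅_⁆; ∣_∣; ⊥; ⊤)
open import Data.Fin.Subset.Properties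
open import Data.List.Base using ([]; _∷_)
open import Data.List.Relation.Unary.All using ([]; _∷_)
open import Data.List.Relation.Unary.AllPairs using ([]; _∷_)
open import Data.Nat.Base
  using (ℕ; zero; suc; _+_; _*_; _≤_; _<_; z≤n; s≤s)
open import Data.Nat.Properties
open import Data.Nat.Solver using (module +-*-Solver)
open import Data.Product.Base
  using (_×_; _,_; ∃; Σ-syntax; proj₁; proj₂)
open import Data.Sum.Base using (_⊎_; inj₁; inj₂)
open import Data.Vec.Base using ([]; _∷_; _++_; take; drop; here; there)
open import Data.Vec.Properties
  using (++-injectiveˡ; ++-injectiveʳ; take++drop≡id; take-zipWith; zipWith-++)
open import Function.Base using (_∘_)
open import Relation.Binary.PropositionalEquality
  using (_≡_; _≢_; refl; sym; trans; cong; cong₂; subst; subst₂)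
open import Relation.Nullary.Decidable using (Dec; yes; no; _×-dec_; ¬?; decidable-stable)
open import Relation.Nullary.Negation.Core using (¬_; contradiction)

-- Subsets of `Fin (m + n)` split at `m`, and cardinalities.

take-++ : ∀ {m n} (p : Subset m) (q : Subset n) → take m (p ++ q) ≡ p
take-++ {m} p q = ++-injectiveˡ _ _ (take++drop≡id m (p ++ q))

drop-++ : ∀ {m n} (p : Subset m) (q : Subset n) → drop m (p ++ q) ≡ q
drop-++ {m} p q = ++-injectiveʳ (take m (p ++ q)) _ (take++drop≡id m (p ++ q))

take-⊆ : ∀ m {n} {p q : Subset (m + n)} → p ⊆ q → take m p ⊆ take m q
take-⊆ (suc m) {p = _ ∷ _} {_ ∷ _} p⊆q here with here ← p⊆q here = here
take-⊆ (suc m) {p = _ ∷ _} {_ ∷ _} p⊆q (there x∈p) =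
  there (take-⊆ m (drop-∷-⊆ p⊆q) x∈p)

∈-drop⁺ : ∀ m {n} {p : Subset (m + n)} {j} → m ↑ʳ j ∈ p → j ∈ drop m p
∈-drop⁺ zero                j∈p         = j∈p
∈-drop⁺ (suc m) {p = _ ∷ _} (there j∈p) = ∈-drop⁺ m j∈p

∈-drop⁻ : ∀ m {n} {p : Subset (m + n)} {j} → j ∈ drop m p → m ↑ʳ j ∈ p
∈-drop⁻ zero                j∈p = j∈p
∈-drop⁻ (suc m) {p = _ ∷ _} j∈p = there (∈-drop⁻ m j∈p)

drop-⊆ : ∀ m {n} {p q : Subset (m + n)} → p ⊆ q → drop m p ⊆ drop m q
drop-⊆ m p⊆q = ∈-drop⁺ m ∘ p⊆q ∘ ∈-drop⁻ m

++⁺-⊆ : ∀ {m n} {p p′ : Subset m} {q q′ : Subset n} →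
        p ⊆ p′ → q ⊆ q′ → p ++ q ⊆ p′ ++ q′
++⁺-⊆ {p = []}    {[]}    _    q⊆q′ x∈ = q⊆q′ x∈
++⁺-⊆ {p = _ ∷ _} {_ ∷ _} p⊆p′ q⊆q′ here with here ← p⊆p′ here = here
++⁺-⊆ {p = _ ∷ _} {_ ∷ _} p⊆p′ q⊆q′ (there x∈) =
  there (++⁺-⊆ (drop-∷-⊆ p⊆p′) q⊆q′ x∈)

∣p++q∣≡∣p∣+∣q∣ : ∀ {m n} (p : Subset m) (q : Subset n) →
                 ∣ p ++ q ∣ ≡ ∣ p ∣ + ∣ q ∣
∣p++q∣≡∣p∣+∣q∣ []          q = refl
∣p++q∣≡∣p∣+∣q∣ (false ∷ p) q = ∣p++q∣≡∣p∣+∣q∣ p q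
∣p++q∣≡∣p∣+∣q∣ (true ∷ p)  q = cong suc (∣p++q∣≡∣p∣+∣q∣ p q)

∣p∪q∣≤∣p∣+∣q∣ : ∀ {n} (p q : Subset n) → ∣ p ∪ q ∣ ≤ ∣ p ∣ + ∣ q ∣
∣p∪q∣≤∣p∣+∣q∣ []          []          = z≤n
∣p∪q∣≤∣p∣+∣q∣ (false ∷ p) (false ∷ q) = ∣p∪q∣≤∣p∣+∣q∣ p q
∣p∪q∣≤∣p∣+∣q∣ (false ∷ p) (true ∷ q)  =
  ≤-trans (s≤s (∣p∪q∣≤∣p∣+∣q∣ p q)) (≤-reflexive (sym (+-suc ∣ p ∣ ∣ q ∣)))
∣p∪q∣≤∣p∣+∣q∣ (true ∷ p)  (false ∷ q) = s≤s (∣p∪q∣≤∣p∣+∣q∣ p q)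
∣p∪q∣≤∣p∣+∣q∣ (true ∷ p)  (true ∷ q)  =
  s≤s (≤-trans (∣p∪q∣≤∣p∣+∣q∣ p q) (+-monoʳ-≤ ∣ p ∣ (n≤1+n ∣ q ∣)))

∣take∣+∣drop∣≡∣p∣ : ∀ m {n} (p : Subset (m + n)) →
                    ∣ take m p ∣ + ∣ drop m p ∣ ≡ ∣ p ∣
∣take∣+∣drop∣≡∣p∣ m p =
  trans (sym (∣p++q∣≡∣p∣+∣q∣ (take m p) (drop m p))) (cong ∣_∣ (take++drop≡id m p))

p⊆q∧∣q∣≤∣p∣⇒p≡q : ∀ {n} {p q : Subset n} → p ⊆ q → ∣ q ∣ ≤ ∣ p ∣ → p ≡ q
p⊆q∧∣q∣≤∣p∣⇒p≡q {p = p} {q} p⊆q ∣q∣≤∣p∣ = ⊆-antisym p⊆q λ {x} x∈q →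
  decidable-stable (x ∈? p) λ x∉p →
    <⇒≱ (p⊂q⇒∣p∣<∣q∣ (p⊆q , x , x∈q , x∉p)) ∣q∣≤∣p∣

∪-lub : ∀ {n} {p q r : Subset n} → p ⊆ r → q ⊆ r → p ∪ q ⊆ r
∪-lub {p = p} {q} p⊆r q⊆r x∈ with x∈p∪q⁻ p q x∈
... | inj₁ x∈p = p⊆r x∈p
... | inj₂ x∈q = q⊆r x∈q

∣p∣<n⇒∃∉ : ∀ {n} (p : Subset n) → ∣ p ∣ < n → ∃ λ x → x ∉ p
∣p∣<n⇒∃∉ {n} p ∣p∣<n = ¬∀⟶∃¬ n (_∈ p) (_∈? p) λ all →
  <⇒≱ ∣p∣<n (subst (_≤ ∣ p ∣) (∣⊤∣≡n n) (p⊆q⇒∣p∣≤∣q∣ {p = ⊤} (λ {x} _ → all x)))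

-- If the union were no larger than `p`, it would coincide with `p` and, the sizes being equal, with
-- `q` as well.
p≢q⇒∣p∣<∣p∪q∣ : ∀ {n} {p q : Subset n} → ∣ p ∣ ≡ ∣ q ∣ → p ≢ q → ∣ p ∣ < ∣ p ∪ q ∣
p≢q⇒∣p∣<∣p∪q∣ {p = p} {q} ∣p∣≡∣q∣ p≢q = ≰⇒> λ ∣p∪q∣≤∣p∣ →
  let p≡p∪q = p⊆q∧∣q∣≤∣p∣⇒p≡q (p⊆p∪q {p = p} q) ∣p∪q∣≤∣p∣
      q≡p∪q = p⊆q∧∣q∣≤∣p∣⇒p≡q (q⊆p∪q p q) (subst (∣ p ∪ q ∣ ≤_) ∣p∣≡∣q∣ ∣p∪q∣≤∣p∣)
  in p≢q (trans p≡p∪q (sym q≡p∪q))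

-- The independence system of a spread family of blocks.

module BlockSystem {m N t : ℕ} (S : Fin N → Subset m) (0<t : 0 < t)
  (∣S∣≡t  : ∀ j → ∣ S j ∣ ≡ t)
  (spread : ∀ {i j} → i ≢ j → suc t < ∣ S i ∪ S j ∣) where

  trace : Subset (m + N) → Subset m
  trace = take m

  -- The right summand of the ground set plays the role of Y, so yⱼ is `m ↑ʳ j`.
  block : Fin N → Subset (m + N)
  block j = S j ++ ⁅ j ⁆

  Independent : Subset (m + N) → Set
  Independent J = ∣ trace J ∣ ≤ t × (∀ j → ¬ block j ⊆ J)

  independent? : ∀ J → Dec (Independent J)
  independent? J = ∣ trace J ∣ ≤? t ×-dec all? λ j → ¬? (block j ⊆? J)

  downward-closed : ∀ {I J} → J ⊆ I → Independent I → Independent J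
  downward-closed J⊆I (small , block⊈I) =
    ≤-trans (p⊆q⇒∣p∣≤∣q∣ (take-⊆ m J⊆I)) small ,
    λ j block⊆J → block⊈I j (⊆-trans block⊆J J⊆I)

  X Y : Subset (m + N)
  X = ⊤ {m} ++ ⊥ {N}
  Y = ⊥ {m} ++ ⊤ {N}

  S⊆trace : ∀ {j J} → block j ⊆ J → S j ⊆ trace J
  S⊆trace {j} {J} block⊆J =
    subst (_⊆ trace J) (take-++ (S j) ⁅ j ⁆) (take-⊆ m block⊆J)

  index∈ : ∀ {j J} → block j ⊆ J → j ∈ drop m J
  index∈ {j} {J} block⊆J =
    subst (_⊆ drop m J) (drop-++ (S j) ⁅ j ⁆) (drop-⊆ m block⊆J) (x∈⁅x⁆ j)

  -- No block fits into `Y`: it has `t` > 0 elements in `X`, where `Y` has none.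
  Y-independent : Independent Y
  Y-independent = ≤-trans (≤-reflexive ∣trace∣≡0) z≤n , λ j block⊆Y →
    <⇒≱ 0<t (subst₂ _≤_ (∣S∣≡t j) ∣trace∣≡0 (p⊆q⇒∣p∣≤∣q∣ (S⊆trace block⊆Y)))
    where
    ∣trace∣≡0 : ∣ trace Y ∣ ≡ 0
    ∣trace∣≡0 = trans (cong ∣_∣ (take-++ {m} ⊥ ⊤)) (∣⊥∣≡0 m)

  system : IndependenceSystem (m + N)
  system = record
    { Independent     = Independent
    ; independent?    = independent?
    ; nonempty        = Y , Y-independent
    ; downward-closed = downward-closed
    }

  -- Circuits of the system.

  dependent : ∀ {J} → ¬ Independent J → t < ∣ trace J ∣ ⊎ ∃ λ j → block j ⊆ J
  -- A finite search for a contained block turns the negated conjunction into a constructive choice.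
  dependent {J} ¬ind with any? (λ j → block j ⊆? J)
  ... | yes ∃block = inj₂ ∃block
  ... | no ¬∃block = inj₁ (≰⇒> λ small → ¬ind (small , λ j b → ¬∃block (j , b)))

  -- The part of `C` in `X` is already dependent by its size, so minimality leaves nothing of `C`
  -- outside `X`.
  circuit-in-trace : ∀ {C} → Circuit system C → t < ∣ trace C ∣ → trace C ++ ⊥ ≡ C
  circuit-in-trace {C} (_ , minimal) large = minimal
    (λ (small , _) →
      <⇒≱ large (subst (λ A → ∣ A ∣ ≤ t) (take-++ (trace C) ⊥) small))
    (subst (trace C ++ ⊥ ⊆_) (take++drop≡id m C) (++⁺-⊆ {p = trace C} ⊆-refl ⊥⊆))

  circuit-block : ∀ {C j} → Circuit system C → block j ⊆ C → block j ≡ C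
  circuit-block {j = j} (_ , minimal) = minimal λ (_ , block⊈) → block⊈ j ⊆-refl

  module _ {J} (∣trace∣≤1+t : ∣ trace J ∣ ≤ suc t) where

    -- Both traces have at least t + 1 elements and lie in `trace J`, which has at most t + 1; hence
    -- both are all of `trace J`.
    large-circuits≡ : ∀ {C D} →
      Circuit system C × C ⊆ J → Circuit system D × D ⊆ J →
      t < ∣ trace C ∣ → t < ∣ trace D ∣ → C ≡ D
    large-circuits≡ (circC , C⊆J) (circD , D⊆J) largeC largeD =
      trans (sym (circuit-in-trace circC largeC))
        (trans (cong (_++ ⊥) (trans (trace≡ C⊆J largeC) (sym (trace≡ D⊆J largeD))))
          (circuit-in-trace circD largeD))
      where
      trace≡ : ∀ {C} → C ⊆ J → t < ∣ trace C ∣ → trace C ≡ trace J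
      trace≡ C⊆J large = p⊆q∧∣q∣≤∣p∣⇒p≡q (take-⊆ m C⊆J) (≤-trans ∣trace∣≤1+t large)

    -- Two different blocks would force at least t + 2 elements into `trace J`.
    block-unique : ∀ {i j} → block i ⊆ J → block j ⊆ J → i ≡ j
    block-unique {i} {j} bi⊆J bj⊆J = decidable-stable (i ≟ᶠ j) λ i≢j →
      <⇒≱ (spread i≢j)
        (≤-trans (p⊆q⇒∣p∣≤∣q∣ (∪-lub (S⊆trace bi⊆J) (S⊆trace bj⊆J))) ∣trace∣≤1+t)

    block-circuits≡ : ∀ {C D} →
      Circuit system C × C ⊆ J → Circuit system D × D ⊆ J →
      (∃ λ i → block i ⊆ C) → (∃ λ j → block j ⊆ D) → C ≡ D
    block-circuits≡ (circC , C⊆J) (circD , D⊆J) (_ , bi⊆C) (_ , bj⊆D) =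
      trans (sym (circuit-block circC bi⊆C))
        (trans (cong block (block-unique (⊆-trans bi⊆C C⊆J) (⊆-trans bj⊆D D⊆J)))
          (circuit-block circD bj⊆D))

    -- Pigeonhole: a circuit either is large in `X` or contains a block, and `J` has at most one
    -- circuit of each kind.
    no-three-circuits : ∀ {C D E} →
      Circuit system C × C ⊆ J → Circuit system D × D ⊆ J → Circuit system E × E ⊆ J →
      C ≢ D → C ≢ E → ¬ D ≢ E
    no-three-circuits c d e C≢D C≢E D≢E
      with dependent (proj₁ (proj₁ c)) | dependent (proj₁ (proj₁ d)) | dependent (proj₁ (proj₁ e))
    ... | inj₁ x | inj₁ y | _      = C≢D (large-circuits≡ c d x y)
    ... | inj₁ x | inj₂ _ | inj₁ z = C≢E (large-circuits≡ c e x z)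
    ... | inj₁ _ | inj₂ y | inj₂ z = D≢E (block-circuits≡ d e y z)
    ... | inj₂ _ | inj₁ y | inj₁ z = D≢E (large-circuits≡ d e y z)
    ... | inj₂ x | inj₁ _ | inj₂ z = C≢E (block-circuits≡ c e x z)
    ... | inj₂ x | inj₂ y | _      = C≢D (block-circuits≡ c d x y)

  ∣trace-∪⁅⁆∣≤1+t : ∀ {I} e → Independent I → ∣ trace (I ∪ ⁅ e ⁆) ∣ ≤ suc t
  ∣trace-∪⁅⁆∣≤1+t {I} e (small , _) = begin
    ∣ trace (I ∪ ⁅ e ⁆) ∣            ≡⟨ cong ∣_∣ (take-zipWith {m = m} _ I ⁅ e ⁆) ⟩
    ∣ trace I ∪ trace ⁅ e ⁆ ∣        ≤⟨ ∣p∪q∣≤∣p∣+∣q∣ (trace I) (trace ⁅ e ⁆) ⟩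
    ∣ trace I ∣ + ∣ trace ⁅ e ⁆ ∣    ≤⟨ +-mono-≤ small ∣trace⁅e⁆∣≤1 ⟩
    t + 1                            ≡⟨ +-comm t 1 ⟩
    suc t                            ∎
    where
    open ≤-Reasoning
    ∣trace⁅e⁆∣≤1 : ∣ trace ⁅ e ⁆ ∣ ≤ 1
    ∣trace⁅e⁆∣≤1 = subst (∣ trace ⁅ e ⁆ ∣ ≤_)
      (trans (∣take∣+∣drop∣≡∣p∣ m ⁅ e ⁆) (∣⁅x⁆∣≡1 e)) (m≤m+n _ _)

  circuitBounded : CircuitBounded system 2
  circuitBounded I e ind _ []               _ _ = z≤n
  circuitBounded I e ind _ (_ ∷ [])         _ _ = s≤s z≤n
  circuitBounded I e ind _ (_ ∷ _ ∷ [])     _ _ = s≤s (s≤s z≤n)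
  circuitBounded I e ind _ (_ ∷ _ ∷ _ ∷ _)
    ((C≢D ∷ C≢E ∷ _) ∷ (D≢E ∷ _) ∷ _) (c ∷ d ∷ e′ ∷ _) =
    contradiction D≢E
      (no-three-circuits (∣trace-∪⁅⁆∣≤1+t e ind) c d e′ C≢D C≢E)

  -- Failure of growth.

  S-basis : ∀ j → Basis system X (S j ++ ⊥)
  S-basis j = ((small , no-block) , ++⁺-⊆ {p = S j} {q = ⊥} ⊆⊤ ⊆-refl) , maximal
    where
    small : ∣ trace (S j ++ ⊥) ∣ ≤ t
    small = ≤-reflexive (trans (cong ∣_∣ (take-++ (S j) ⊥)) (∣S∣≡t j))

    no-block : ∀ i → ¬ block i ⊆ S j ++ ⊥
    no-block i block⊆ = ∉⊥ (subst (i ∈_) (drop-++ (S j) ⊥) (index∈ block⊆))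

    -- An independent `B` has at most `t` elements in `X`, and `S j` already supplies `t` of them.
    maximal : ∀ {B} → Independent B × B ⊆ X → S j ++ ⊥ ⊆ B → B ≡ S j ++ ⊥
    maximal {B} ((∣B∣≤t , _) , B⊆X) S⊆B =
      trans (sym (take++drop≡id m B)) (cong₂ _++_ (sym S≡trace) drop≡⊥)
      where
      S≡trace : S j ≡ trace B
      S≡trace = p⊆q∧∣q∣≤∣p∣⇒p≡q
        (subst (_⊆ trace B) (take-++ (S j) ⊥) (take-⊆ m S⊆B))
        (subst (∣ trace B ∣ ≤_) (sym (∣S∣≡t j)) ∣B∣≤t)

      drop≡⊥ : drop m B ≡ ⊥
      drop≡⊥ = ⊆-antisym
        (subst (drop m B ⊆_) (drop-++ {m} ⊤ ⊥) (drop-⊆ m B⊆X)) ⊥⊆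

  -- This bounds how many yⱼ the discarded part `Z` can absorb.
  ∣drop∣≤km : ∀ k (Z : Subset (m + N)) → ∣ Z ∣ ≤ k * ∣ X ─ Y ∣ → ∣ drop m Z ∣ ≤ k * m
  ∣drop∣≤km k Z ∣Z∣≤ = begin
    ∣ drop m Z ∣                  ≤⟨ m≤n+m _ _ ⟩
    ∣ take m Z ∣ + ∣ drop m Z ∣   ≡⟨ ∣take∣+∣drop∣≡∣p∣ m Z ⟩
    ∣ Z ∣                         ≤⟨ ∣Z∣≤ ⟩
    k * ∣ X ─ Y ∣                 ≤⟨ *-monoʳ-≤ k (∣p─q∣≤∣p∣ X Y) ⟩
    k * ∣ X ∣                     ≡⟨ cong (k *_) ∣X∣≡m ⟩
    k * m                         ∎
    where
    open ≤-Reasoning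
    ∣X∣≡m : ∣ X ∣ ≡ m
    ∣X∣≡m = trans (∣p++q∣≡∣p∣+∣q∣ {m} {N} ⊤ ⊥)
      (trans (cong₂ _+_ (∣⊤∣≡n m) (∣⊥∣≡0 N)) (+-identityʳ m))

  ¬growth : ∀ {k} → k * m < N → ¬ Growth system k
  ¬growth {k} km<N growth
    with Q , Z , (Q∪Z≡Y─X , _) , ∣Z∣≤ , extends ← growth X Y Y-independent
    -- There are N > k m elements yⱼ, so some yⱼ escapes `Z` and must lie in `Q`; the basis `S j`
    -- together with `Q` then contains the block of index `j`.
    with j , j∉ ← ∣p∣<n⇒∃∉ (drop m Z) (≤-<-trans (∣drop∣≤km k Z ∣Z∣≤) km<N)
    = proj₂ (extends (S j ++ ⊥) (S-basis j)) j block⊆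
    where
    y∈Y─X : m ↑ʳ j ∈ Y ─ X
    y∈Y─X = x∈p∧x∉q⇒x∈p─q
      (∈-drop⁻ m (subst (j ∈_) (sym (drop-++ {m} {N} ⊥ ⊤)) ∈⊤))
      (λ y∈X → ∉⊥ (subst (j ∈_) (drop-++ {m} {N} ⊤ ⊥) (∈-drop⁺ m y∈X)))

    j∈Q : j ∈ drop m Q
    j∈Q with x∈p∪q⁻ Q Z (subst (m ↑ʳ j ∈_) (sym Q∪Z≡Y─X) y∈Y─X)
    ... | inj₁ y∈Q = ∈-drop⁺ m y∈Q
    ... | inj₂ y∈Z = contradiction (∈-drop⁺ m y∈Z) j∉

    block⊆ : block j ⊆ (S j ++ ⊥) ∪ Q
    block⊆ = subst (block j ⊆_) (take++drop≡id m ((S j ++ ⊥) ∪ Q)) (++⁺-⊆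
      (subst (_⊆ take m ((S j ++ ⊥) ∪ Q)) (take-++ (S j) ⊥) (take-⊆ m (p⊆p∪q Q)))
      (λ x∈⁅j⁆ → subst (_∈ drop m ((S j ++ ⊥) ∪ Q)) (sym (x∈⁅y⁆⇒x≡y j x∈⁅j⁆))
        (drop-⊆ m (q⊆p∪q (S j ++ ⊥) Q) j∈Q)))

-- The block family: doubled edges of the complete bipartite graph on q + q vertices.

pair : ∀ q → Fin (q * q) → Subset (q + q)
pair q x = let i , j = remQuot {q} q x in ⁅ i ⁆ ++ ⁅ j ⁆

∣pair∣≡2 : ∀ q x → ∣ pair q x ∣ ≡ 2
∣pair∣≡2 q x = let i , j = remQuot {q} q x in
  trans (∣p++q∣≡∣p∣+∣q∣ ⁅ i ⁆ ⁅ j ⁆) (cong₂ _+_ (∣⁅x⁆∣≡1 i) (∣⁅x⁆∣≡1 j))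

⁅⁆-injective : ∀ {n} {i j : Fin n} → ⁅ i ⁆ ≡ ⁅ j ⁆ → i ≡ j
⁅⁆-injective {i = i} {j} eq = x∈⁅y⁆⇒x≡y j (subst (i ∈_) eq (x∈⁅x⁆ i))

pair-injective : ∀ q {x y} → pair q x ≡ pair q y → x ≡ y
pair-injective q {x} {y} eq =
  let i , _ = remQuot {q} q x
      j , _ = remQuot {q} q y
  in trans (sym (combine-remQuot {q} q x)) (trans
    (cong₂ combine
      (⁅⁆-injective (++-injectiveˡ ⁅ i ⁆ ⁅ j ⁆ eq))
      (⁅⁆-injective (++-injectiveʳ ⁅ i ⁆ ⁅ j ⁆ eq)))
    (combine-remQuot {q} q y))

double : ∀ {n} → Subset n → Subset (n + n)
double p = p ++ p

-- Distinct sets of equal size gain at least one element in their union; two disjoint copies gain at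
-- least two, as `spread` demands.
∣double∪double∣ : ∀ {n} {p q : Subset n} → ∣ p ∣ ≡ ∣ q ∣ → p ≢ q →
                  suc ∣ double p ∣ < ∣ double p ∪ double q ∣
∣double∪double∣ {p = p} {q} ∣p∣≡∣q∣ p≢q = begin
  2 + ∣ double p ∣             ≡⟨ cong (2 +_) (∣p++q∣≡∣p∣+∣q∣ p p) ⟩
  2 + (∣ p ∣ + ∣ p ∣)          ≡⟨ cong suc (sym (+-suc ∣ p ∣ ∣ p ∣)) ⟩
  suc ∣ p ∣ + suc ∣ p ∣        ≤⟨ +-mono-≤ ∣p∣<∣p∪q∣ ∣p∣<∣p∪q∣ ⟩
  ∣ p ∪ q ∣ + ∣ p ∪ q ∣        ≡⟨ ∣p++q∣≡∣p∣+∣q∣ (p ∪ q) (p ∪ q) ⟨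
  ∣ double (p ∪ q) ∣           ≡⟨ cong ∣_∣ (zipWith-++ _ p p q q) ⟨
  ∣ double p ∪ double q ∣      ∎
  where
  open ≤-Reasoning
  ∣p∣<∣p∪q∣ : ∣ p ∣ < ∣ p ∪ q ∣
  ∣p∣<∣p∪q∣ = p≢q⇒∣p∣<∣p∪q∣ ∣p∣≡∣q∣ p≢q

theorem13 : (k : ℕ) → 2 ≤ k →
    ∃ λ (n : ℕ) → Σ[ 𝓢 ∈ IndependenceSystem n ] (CircuitBounded 𝓢 2 × ¬ Growth 𝓢 k)
theorem13 k _ = _ , system , circuitBounded , ¬growth {k} km<N
  where
  q : ℕ
  -- The blocks live on 4q points, so `km<N` asks for 4kq < q², that is, 4k < q.
  q = suc (4 * k)

  S : Fin (q * q) → Subset ((q + q) + (q + q))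
  S x = double (pair q x)

  ∣S∣≡4 : ∀ x → ∣ S x ∣ ≡ 4
  ∣S∣≡4 x = trans (∣p++q∣≡∣p∣+∣q∣ (pair q x) (pair q x))
    (cong₂ _+_ (∣pair∣≡2 q x) (∣pair∣≡2 q x))

  spread : ∀ {x y} → x ≢ y → 5 < ∣ S x ∪ S y ∣
  spread {x} {y} x≢y = subst (λ s → suc s < ∣ S x ∪ S y ∣) (∣S∣≡4 x)
    (∣double∪double∣ (trans (∣pair∣≡2 q x) (sym (∣pair∣≡2 q y)))
      (x≢y ∘ pair-injective q))

  km<N : k * ((q + q) + (q + q)) < q * q
  km<N = subst (_< q * q) (four k q) (*-monoˡ-< q (n<1+n (4 * k)))
    where
    open +-*-Solver
    four : ∀ k q → 4 * k * q ≡ k * ((q + q) + (q + q))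
    four = solve 2 (λ k q → con 4 :* k :* q := k :* ((q :+ q) :+ (q :+ q))) refl

  open BlockSystem S (s≤s z≤n) ∣S∣≡4 spread
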